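{- Let $F\in\mathbb{Z}[x,y]$ be a polynomial of degree $2$ which represents arbitrarily large (positive) integers and such that $\frac{\partial F}{\partial x},\frac{\partial F}{\partial y}$ are linearly independent. If the image $F(\mathbb{Z}^2)$ contains an arithmetic progression $\{An+B: n\in\mathbb{Z}\}$ with $A,B\in\mathbb{Z}$, $A\neq0$, then $$N\ll\psi_F(N)\ll N.$$
   Context: An integer $n$ is represented by $F$ if $n=F(x_0,y_0)$ for some $x_0,y_0\in\mathbb{Z}$. For $N\ge1$, $\psi_F(N)=\log\left(\mathrm{LCM}\{F(x,y): x,y\in\mathbb{Z},\ 0<F(x,y)\le N\}\right)$. Linear independence is as polynomials over $\mathbb{Q}$. The estimates hold for all sufficiently large $N$, with positive implied constants that may depend on $F$. -}

module Defs where

open import Data.Nat as ℕ using (ℕ; zero; suc; pred; s≤s)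
import Data.Nat.Properties as ℕ
open import Data.Nat.Divisibility using (_∣_; 1∣_; ∣-trans; ∣-antisym)
open import Data.Nat.LCM using (lcm; m∣lcm[m,n]; n∣lcm[m,n]; lcm-least)
open import Data.Nat.Solver using (module +-*-Solver)
open import Data.Fin using (toℕ)
open import Data.Integer as ℤ using (ℤ; +_; 0ℤ)
import Data.Integer.Properties as ℤ
open import Data.Rational as ℚ using (ℚ; 0ℚ; 1ℚ; _/_)
import Data.Rational.Properties as ℚ
import Data.Rational.Unnormalised as ℚᵘ
import Data.Rational.Unnormalised.Properties as ℚᵘ
open import Data.Product using (∃; _×_; _,_; proj₁; proj₂)
open import Function using (_∘_)
open import Data.Sum using ([_,_]′)
open import Relation.Nullary using (¬_; Dec; yes; no; contradiction)
open import Relation.Nullary.Decidable using (¬¬-excluded-middle)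
open import Relation.Binary.PropositionalEquality
open import Algebra.Properties.CommutativeMonoid.Sum ℤ.+-0-commutativeMonoid using (sum⁺-syntax)
import Algebra.Properties.CommutativeMonoid.Sum ℚ.+-0-commutativeMonoid as Sumℚ

-- coeff i j is the coefficient of xⁱyʲ.  The degree bound only witnesses
-- finite support; it need not be sharp.
record ℤ[x,y] : Set where
  field
    coeff   : ℕ → ℕ → ℤ
    bound   : ℕ
    bounded : ∀ i j → bound ℕ.< i ℕ.+ j → coeff i j ≡ 0ℤ

open ℤ[x,y] public

eval : ℤ[x,y] → ℤ → ℤ → ℤ
eval F x y =
  ∑[ i ≤ bound F ] ∑[ j ≤ bound F ]
    (coeff F (toℕ i) (toℕ j) ℤ.* (x ℤ.^ toℕ i ℤ.* y ℤ.^ toℕ j))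

HasDegree : ℤ[x,y] → ℕ → Set
HasDegree F d =
  (∃ λ i → ∃ λ j → i ℕ.+ j ≡ d × coeff F i j ≢ 0ℤ) ×
  (∀ i j → d ℕ.< i ℕ.+ j → coeff F i j ≡ 0ℤ)

∂x : ℤ[x,y] → ℤ[x,y]
∂x F .coeff i j       = + suc i ℤ.* coeff F (suc i) j
∂x F .bound           = bound F
∂x F .bounded i j b<s =
  trans (cong (+ suc i ℤ.*_) (bounded F (suc i) j (ℕ.m<n⇒m<1+n b<s)))
        (ℤ.*-zeroʳ (+ suc i))

∂y : ℤ[x,y] → ℤ[x,y]
∂y F .coeff i j       = + suc j ℤ.* coeff F i (suc j)
∂y F .bound           = bound F
∂y F .bounded i j b<s =
  trans (cong (+ suc j ℤ.*_)
          (bounded F i (suc j)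
            (subst (bound F ℕ.<_) (sym (ℕ.+-suc i j)) (ℕ.m<n⇒m<1+n b<s))))
        (ℤ.*-zeroʳ (+ suc j))

LinearlyIndependent : ℤ[x,y] → ℤ[x,y] → Set
LinearlyIndependent P Q =
  ∀ (α β : ℚ) →
  (∀ i j → α ℚ.* (coeff P i j / 1) ℚ.+ β ℚ.* (coeff Q i j / 1) ≡ 0ℚ) →
  α ≡ 0ℚ × β ≡ 0ℚ

Represents : ℤ[x,y] → ℤ → Set
Represents F n = ∃ λ x → ∃ λ y → eval F x y ≡ n

RepresentsArbitrarilyLarge : ℤ[x,y] → Set
RepresentsArbitrarilyLarge F = ∀ (M : ℕ) → ∃ λ n → + M ℤ.< n × Represents F n

record LCM (S : ℕ → Set) : Set where
  field
    value          : ℕ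
    commonMultiple : ∀ {v} → S v → v ∣ value
    least          : ∀ {m} → (∀ {v} → S v → v ∣ m) → value ∣ m

open LCM public

LCM-unique : ∀ {S} (k ℓ : LCM S) → value k ≡ value ℓ
LCM-unique k ℓ =
  ∣-antisym (least k (commonMultiple ℓ)) (least ℓ (commonMultiple k))

-- For a bounded set that is not known to be decidable, the existence of
-- the LCM is only available under a double negation.
LCM-exists : ∀ {S} N → (∀ {v} → S v → v ℕ.< N) → ¬ ¬ LCM S
LCM-exists zero S<N k = k record
  { value          = 1
  ; commonMultiple = λ s → contradiction (S<N s) λ ()
  ; least          = λ _ → 1∣ _
  }
LCM-exists {S} (suc N) S<1+N k =
  LCM-exists {S′} N proj₂ λ ℓ → ¬¬-excluded-middle (k ∘ extend ℓ)
  where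
  S′ : ℕ → Set
  S′ v = S v × v ℕ.< N

  extend : LCM S′ → Dec (S N) → LCM S
  extend ℓ (yes sN) = record
    { value          = lcm (value ℓ) N
    ; commonMultiple = λ s → [ (λ v<N → ∣-trans (commonMultiple ℓ (s , v<N)) (m∣lcm[m,n] (value ℓ) N))
                             , (λ { refl → n∣lcm[m,n] (value ℓ) N })
                             ]′ (ℕ.m<1+n⇒m<n∨m≡n (S<1+N s))
    ; least          = λ h → lcm-least (least ℓ (h ∘ proj₁)) (h sN)
    }
  extend ℓ (no ¬sN) = record
    { value          = value ℓ
    ; commonMultiple = λ s → [ (λ v<N → commonMultiple ℓ (s , v<N))
                             , (λ { refl → contradiction s ¬sN })
                             ]′ (ℕ.m<1+n⇒m<n∨m≡n (S<1+N s))
    ; least          = λ h → least ℓ (h ∘ proj₁)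
    }

-- A real number is given by rational intervals [lower m , upper m] that
-- contain it, with width at most 1/(m+1).
record ℝ : Set where
  field
    lower upper : ℕ → ℚ
    ordered     : ∀ m k → lower m ℚ.≤ upper k
    width       : ∀ m → upper m ℚ.≤ lower m ℚ.+ (+ 1 / suc m)

open ℝ public

infix 4 _≤ᵣ_

-- As the widths tend to 0, this says exactly that x does not exceed y.
_≤ᵣ_ : ℝ → ℝ → Set
x ≤ᵣ y = ∀ m k → lower x m ℚ.≤ upper y k

1/1+_ : ℕ → ℚ
1/1+ d = + 1 / suc d

1/1+-nonNeg : ∀ d → 0ℚ ℚ.≤ 1/1+ d
1/1+-nonNeg d = ℚ.nonNegative⁻¹ (1/1+ d) {{ℚ.normalize-nonNeg 1 (suc d)}}

p≤p+1/1+ : ∀ p d → p ℚ.≤ p ℚ.+ 1/1+ d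
p≤p+1/1+ p d =
  subst (ℚ._≤ p ℚ.+ 1/1+ d) (ℚ.+-identityʳ p) (ℚ.+-monoʳ-≤ p (1/1+-nonNeg d))

fromℚ : ℚ → ℝ
fromℚ q = record
  { lower   = λ _ → q
  ; upper   = λ _ → q
  ; ordered = λ _ _ → ℚ.≤-refl
  ; width   = p≤p+1/1+ q
  }

∑< : ℕ → (ℕ → ℚ) → ℚ
∑< n f = Sumℚ.sum {n} (f ∘ toℕ)

-- Darboux sums of ∫₁ⁿ dt/t for the subdivision of [1,n] into
-- (n-1)(m+1) intervals of length 1/(m+1): the i-th one contributes
-- 1/(m+1+(i+1)) to the lower and 1/(m+1+i) to the upper sum.
log-lower log-upper : ℕ → ℕ → ℚ
log-lower n m = ∑< (pred n ℕ.* suc m) (λ i → 1/1+ (suc m ℕ.+ i))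
log-upper n m = ∑< (pred n ℕ.* suc m) (λ i → 1/1+ (m ℕ.+ i))

1/1+-anti : ∀ {c d} → c ℕ.≤ d → 1/1+ d ℚ.≤ 1/1+ c
1/1+-anti {c} {d} c≤d = ℚ.toℚᵘ-cancel-≤ (begin
  ℚ.toℚᵘ (1/1+ d)   ≃⟨ ℚ.toℚᵘ-fromℚᵘ (ℚᵘ.mkℚᵘ (+ 1) d) ⟩
  ℚᵘ.mkℚᵘ (+ 1) d   ≤⟨ ℚᵘ.*≤* (ℤ.*-monoˡ-≤-nonNeg (+ 1) (ℤ.+≤+ (s≤s c≤d))) ⟩
  ℚᵘ.mkℚᵘ (+ 1) c   ≃⟨ ℚ.toℚᵘ-fromℚᵘ (ℚᵘ.mkℚᵘ (+ 1) c) ⟨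
  ℚ.toℚᵘ (1/1+ c)   ∎)
  where open ℚᵘ.≤-Reasoning

∑<-mono : ∀ n (f g : ℕ → ℚ) → (∀ i → i ℕ.< n → f i ℚ.≤ g i) → ∑< n f ℚ.≤ ∑< n g
∑<-mono zero    f g h = ℚ.≤-refl
∑<-mono (suc n) f g h =
  ℚ.+-mono-≤ (h 0 (s≤s ℕ.z≤n)) (∑<-mono n (f ∘ suc) (g ∘ suc) (λ i i<n → h (suc i) (s≤s i<n)))

∑<-cong : ∀ n {f g : ℕ → ℚ} → (∀ i → f i ≡ g i) → ∑< n f ≡ ∑< n g
∑<-cong n h = Sumℚ.sum-cong-≗ {n} (h ∘ toℕ)

∑<-shift : ∀ n (f : ℕ → ℚ) → ∑< n f ℚ.+ f n ≡ f 0 ℚ.+ ∑< n (f ∘ suc)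
∑<-shift zero    f = ℚ.+-comm 0ℚ (f 0)
∑<-shift (suc n) f =
  trans (ℚ.+-assoc (f 0) _ _) (cong (f 0 ℚ.+_) (∑<-shift n (f ∘ suc)))

∑<-+ : ∀ k n (f : ℕ → ℚ) → ∑< (k ℕ.+ n) f ≡ ∑< k f ℚ.+ ∑< n (f ∘ (k ℕ.+_))
∑<-+ zero    n f = sym (ℚ.+-identityˡ _)
∑<-+ (suc k) n f =
  trans (cong (f 0 ℚ.+_) (∑<-+ k n (f ∘ suc))) (sym (ℚ.+-assoc (f 0) _ _))

∑<-* : ∀ n k (f : ℕ → ℚ) → ∑< (n ℕ.* k) f ≡ ∑< n (λ i → ∑< k (λ j → f (i ℕ.* k ℕ.+ j)))
∑<-* zero    k f = refl
∑<-* (suc n) k f = trans (∑<-+ k (n ℕ.* k) f)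
  (cong (∑< k f ℚ.+_)
    (trans (∑<-* n k (f ∘ (k ℕ.+_)))
      (∑<-cong n λ i → ∑<-cong k λ j → cong f (sym (ℕ.+-assoc k (i ℕ.* k) j)))))

∑<-const : ∀ n c → ∑< n (λ _ → c) ≡ (+ n / 1) ℚ.* c
∑<-const zero    c = sym (ℚ.*-zeroˡ c)
∑<-const (suc n) c = begin
  c ℚ.+ ∑< n (λ _ → c)              ≡⟨ cong (c ℚ.+_) (∑<-const n c) ⟩
  c ℚ.+ (+ n / 1) ℚ.* c             ≡⟨ cong (ℚ._+ (+ n / 1) ℚ.* c) (ℚ.*-identityˡ c) ⟨
  1ℚ ℚ.* c ℚ.+ (+ n / 1) ℚ.* c      ≡⟨ ℚ.*-distribʳ-+ c 1ℚ (+ n / 1) ⟨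
  (1ℚ ℚ.+ (+ n / 1)) ℚ.* c          ≡⟨ cong (ℚ._* c) 1+n ⟩
  (+ suc n / 1) ℚ.* c               ∎
  where
  open ≡-Reasoning
  module R = ℚᵘ.≃-Reasoning
  1+n : 1ℚ ℚ.+ (+ n / 1) ≡ + suc n / 1
  1+n = ℚ.toℚᵘ-injective (R.begin
    ℚ.toℚᵘ (1ℚ ℚ.+ (+ n / 1))                R.≈⟨ ℚ.toℚᵘ-homo-+ 1ℚ (+ n / 1) ⟩
    ℚᵘ.1ℚᵘ ℚᵘ.+ ℚ.toℚᵘ (+ n / 1)             R.≈⟨ ℚᵘ.+-congʳ ℚᵘ.1ℚᵘ (ℚ.toℚᵘ-fromℚᵘ (ℚᵘ.mkℚᵘ (+ n) 0)) ⟩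
    ℚᵘ.1ℚᵘ ℚᵘ.+ ℚᵘ.mkℚᵘ (+ n) 0              R.≈⟨ ℚᵘ.*≡* (cong (λ t → (+ 1 ℤ.+ t) ℤ.* + 1) (ℤ.*-identityʳ (+ n))) ⟩
    ℚᵘ.mkℚᵘ (+ suc n) 0                      R.≈⟨ ℚᵘ.≃-sym (ℚ.toℚᵘ-fromℚᵘ (ℚᵘ.mkℚᵘ (+ suc n) 0)) ⟩
    ℚ.toℚᵘ (+ suc n / 1)                     R.∎)

-- (k+1) copies of 1/((k+1)(d+1)) add up to 1/(d+1).
∑<-1/1+ : ∀ k d → ∑< (suc k) (λ _ → 1/1+ (k ℕ.+ d ℕ.* suc k)) ≡ 1/1+ d
∑<-1/1+ k d = trans (∑<-const (suc k) (1/1+ e)) (ℚ.toℚᵘ-injective (begin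
  ℚ.toℚᵘ ((+ suc k / 1) ℚ.* 1/1+ e)                ≈⟨ ℚ.toℚᵘ-homo-* (+ suc k / 1) (1/1+ e) ⟩
  ℚ.toℚᵘ (+ suc k / 1) ℚᵘ.* ℚ.toℚᵘ (1/1+ e)        ≈⟨ ℚᵘ.*-cong (ℚ.toℚᵘ-fromℚᵘ (ℚᵘ.mkℚᵘ (+ suc k) 0)) (ℚ.toℚᵘ-fromℚᵘ (ℚᵘ.mkℚᵘ (+ 1) e)) ⟩
  ℚᵘ.mkℚᵘ (+ suc k) 0 ℚᵘ.* ℚᵘ.mkℚᵘ (+ 1) e         ≈⟨ ℚᵘ.*≡* (cong +_ (solve 2 (λ k d →
      (con 1 :+ k) :* con 1 :* (con 1 :+ d) :=
      con 1 :* (con 1 :* (con 1 :+ (k :+ d :* (con 1 :+ k))))) refl k d)) ⟩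
  ℚᵘ.mkℚᵘ (+ 1) d                                  ≈⟨ ℚ.toℚᵘ-fromℚᵘ (ℚᵘ.mkℚᵘ (+ 1) d) ⟨
  ℚ.toℚᵘ (1/1+ d)                                  ∎))
  where
  e = k ℕ.+ d ℕ.* suc k
  open ℚᵘ.≃-Reasoning
  open +-*-Solver

-- Both sums are compared with those of the common refinement of mesh
-- 1/(q+1) = 1/((k+1)(m+1)).
log-ordered : ∀ n m k → log-lower n m ℚ.≤ log-upper n k
log-ordered n m k = begin
  ∑< (p ℕ.* suc m) fˡ
    ≤⟨ ∑<-mono (p ℕ.* suc m) fˡ (λ i → ∑< (suc k) (hˡ i)) (λ i _ → refineˡ i) ⟩
  ∑< (p ℕ.* suc m) (λ i → ∑< (suc k) (hˡ i))
    ≡⟨ ∑<-* (p ℕ.* suc m) (suc k) gˡ ⟨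
  ∑< (p ℕ.* suc m ℕ.* suc k) gˡ
    ≤⟨ ∑<-mono (p ℕ.* suc m ℕ.* suc k) gˡ gʳ (λ t _ → 1/1+-anti (ℕ.n≤1+n (q ℕ.+ t))) ⟩
  ∑< (p ℕ.* suc m ℕ.* suc k) gʳ
    ≡⟨ cong (λ s → ∑< s gʳ) (*-swap p (suc m) (suc k)) ⟩
  ∑< (p ℕ.* suc k ℕ.* suc m) gʳ
    ≡⟨ ∑<-* (p ℕ.* suc k) (suc m) gʳ ⟩
  ∑< (p ℕ.* suc k) (λ i → ∑< (suc m) (hʳ i))
    ≤⟨ ∑<-mono (p ℕ.* suc k) (λ i → ∑< (suc m) (hʳ i)) fʳ (λ i _ → refineʳ i) ⟩
  ∑< (p ℕ.* suc k) fʳ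
    ∎
  where
  open ℚ.≤-Reasoning
  open +-*-Solver using (solve; _:+_; _:*_; _:=_; con)

  p = pred n
  q = m ℕ.+ k ℕ.* suc m

  fˡ fʳ gˡ gʳ : ℕ → ℚ
  fˡ i = 1/1+ (suc m ℕ.+ i)
  fʳ i = 1/1+ (k ℕ.+ i)
  gˡ t = 1/1+ (suc q ℕ.+ t)
  gʳ t = 1/1+ (q ℕ.+ t)

  hˡ hʳ : ℕ → ℕ → ℚ
  hˡ i j = gˡ (i ℕ.* suc k ℕ.+ j)
  hʳ i j = gʳ (i ℕ.* suc m ℕ.+ j)

  *-swap : ∀ a b c → a ℕ.* b ℕ.* c ≡ a ℕ.* c ℕ.* b
  *-swap = solve 3 (λ a b c → a :* b :* c := a :* c :* b) refl

  refineˡ : ∀ i → fˡ i ℚ.≤ ∑< (suc k) (hˡ i)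
  refineˡ i = ℚ.≤-trans (ℚ.≤-reflexive (sym (∑<-1/1+ k (suc m ℕ.+ i))))
    (∑<-mono (suc k) (λ _ → 1/1+ (k ℕ.+ (suc m ℕ.+ i) ℕ.* suc k)) (hˡ i)
      λ { j (s≤s j≤k) → 1/1+-anti (ℕ.≤-trans
        (ℕ.+-monoʳ-≤ (suc q) (ℕ.+-monoʳ-≤ (i ℕ.* suc k) j≤k))
        (ℕ.≤-reflexive (solve 3 (λ m k i →
          (con 1 :+ (m :+ k :* (con 1 :+ m))) :+ (i :* (con 1 :+ k) :+ k) :=
          k :+ ((con 1 :+ m) :+ i) :* (con 1 :+ k)) refl m k i))) })

  refineʳ : ∀ i → ∑< (suc m) (hʳ i) ℚ.≤ fʳ i
  refineʳ i = ℚ.≤-trans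
    (∑<-mono (suc m) (hʳ i) (λ _ → 1/1+ (m ℕ.+ (k ℕ.+ i) ℕ.* suc m))
      λ j _ → 1/1+-anti (ℕ.≤-trans
        (ℕ.≤-reflexive (solve 3 (λ m k i →
          m :+ (k :+ i) :* (con 1 :+ m) :=
          (m :+ k :* (con 1 :+ m)) :+ i :* (con 1 :+ m)) refl m k i))
        (ℕ.≤-trans (ℕ.m≤m+n _ j) (ℕ.≤-reflexive (ℕ.+-assoc q (i ℕ.* suc m) j)))))
    (ℚ.≤-reflexive (∑<-1/1+ m (k ℕ.+ i)))

log-width : ∀ n m → log-upper n m ℚ.≤ log-lower n m ℚ.+ 1/1+ m
log-width n m = begin
  log-upper n m                   ≤⟨ p≤p+1/1+ _ (m ℕ.+ a) ⟩
  log-upper n m ℚ.+ 1/1+ (m ℕ.+ a) ≡⟨ ∑<-shift a (λ i → 1/1+ (m ℕ.+ i)) ⟩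
  1/1+ (m ℕ.+ 0) ℚ.+ ∑< a (λ i → 1/1+ (m ℕ.+ suc i))
    ≡⟨ cong₂ ℚ._+_ (cong 1/1+_ (ℕ.+-identityʳ m)) (∑<-cong a λ i → cong 1/1+_ (ℕ.+-suc m i)) ⟩
  1/1+ m ℚ.+ log-lower n m         ≡⟨ ℚ.+-comm (1/1+ m) (log-lower n m) ⟩
  log-lower n m ℚ.+ 1/1+ m         ∎
  where
  open ℚ.≤-Reasoning
  a = pred n ℕ.* suc m

-- log 0 = 0 is a junk value.
log : ℕ → ℝ
log n = record
  { lower   = log-lower n
  ; upper   = log-upper n
  ; ordered = log-ordered n
  ; width   = log-width n
  }

PositiveValuesUpTo : ℤ[x,y] → ℕ → ℕ → Set
PositiveValuesUpTo F N v = 0 ℕ.< v × v ℕ.≤ N × Represents F (+ v)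

PositiveValuesUpTo-LCM : ∀ F N → ¬ ¬ LCM (PositiveValuesUpTo F N)
PositiveValuesUpTo-LCM F N = LCM-exists (suc N) λ (_ , v≤N , _) → s≤s v≤N

-- The values lie between 1 and N, so the LCM divides N ! and the junk
-- value log 0 never occurs.
ψ : (F : ℤ[x,y]) (N : ℕ) → LCM (PositiveValuesUpTo F N) → ℝ
ψ F N ℓ = log (value ℓ)

{-# OPTIONS --safe #-}
module Submission where

-- Lower bound: the image contains the values a i + b (i ∈ ℕ) for some a, b > 0.
-- Whatever gcd(a, b) is, the product of a i + b over k ≤ i ≤ 2k divides
-- a^k k! L whenever each of its factors divides L, and it is at least
-- 2^k a^k k!; hence the LCM is at least 2^k, where k may be taken
-- proportional to N.
--
-- Upper bound: if D is a common multiple of 1, …, n, then D (2n C n) is one of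
-- 1, …, 2n.  Starting from D = 1 and doubling n gives a common multiple
-- of 1, …, 2^k that is at most 2^(2^(k+1)).

open import Defs
open import Data.Nat using (ℕ; _≤_)
open import Data.Integer as ℤ using (ℤ; +_; 0ℤ)
open import Data.Rational as ℚ using (ℚ; 0ℚ; _/_)
open import Data.Product using (∃; _×_)
open import Relation.Binary.PropositionalEquality using (_≢_)

open import Data.Nat as ℕ
  using (zero; suc; pred; _+_; _*_; _∸_; _^_; _<_; _!; z≤n; s≤s; NonZero; >-nonZero; >-nonZero⁻¹)
open import Data.Nat.Properties
open import Data.Nat.Combinatorics using (_C_; nC1≡n; nCk+nC[k+1]≡[n+1]C[k+1])
open import Data.Nat.Divisibility
open import Data.Nat.DivMod using (m/n*n≤m; m≡m%n+[m/n]*n; m%n<n; m≥n⇒m/n>0)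
open import Data.Nat.Tactic.RingSolver using (solve-∀)
import Data.Integer.Properties as ℤ
import Data.Integer.Solver as ℤ
import Data.Rational.Properties as ℚ
open import Data.Product using (_,_)
open import Data.Sum using (inj₁; inj₂)
open import Relation.Binary.PropositionalEquality

[1+k]*[1+n]C[1+k]≡[1+n]*nCk : ∀ n k → suc k * (suc n C suc k) ≡ suc n * (n C k)
[1+k]*[1+n]C[1+k]≡[1+n]*nCk zero    zero    = refl
[1+k]*[1+n]C[1+k]≡[1+n]*nCk zero    (suc k) = *-zeroʳ (suc (suc k))
[1+k]*[1+n]C[1+k]≡[1+n]*nCk (suc n) zero    =
  trans (+-identityʳ _) (trans (nC1≡n (suc (suc n))) (sym (*-identityʳ _)))
[1+k]*[1+n]C[1+k]≡[1+n]*nCk (suc n) (suc k) = begin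
  suc (suc k) * (suc (suc n) C suc (suc k))
    ≡⟨ cong (suc (suc k) *_) (nCk+nC[k+1]≡[n+1]C[k+1] (suc n) (suc k)) ⟨
  suc (suc k) * (c + (suc n C suc (suc k)))
    ≡⟨ *-distribˡ-+ (suc (suc k)) c _ ⟩
  c + suc k * c + suc (suc k) * (suc n C suc (suc k))
    ≡⟨ cong₂ (λ s t → c + s + t) ([1+k]*[1+n]C[1+k]≡[1+n]*nCk n k)
                                 ([1+k]*[1+n]C[1+k]≡[1+n]*nCk n (suc k)) ⟩
  c + suc n * (n C k) + suc n * (n C suc k)
    ≡⟨ +-assoc c _ _ ⟩
  c + (suc n * (n C k) + suc n * (n C suc k))
    ≡⟨ cong (_+_ c) (*-distribˡ-+ (suc n) (n C k) (n C suc k)) ⟨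
  c + suc n * (n C k + n C suc k)
    ≡⟨ cong (λ t → c + suc n * t) (nCk+nC[k+1]≡[n+1]C[k+1] n k) ⟩
  suc (suc n) * c ∎
  where
  open ≡-Reasoning
  c = suc n C suc k

nCk≤2^n : ∀ n k → n C k ≤ 2 ^ n
nCk≤2^n zero    zero    = ≤-refl
nCk≤2^n zero    (suc k) = z≤n
nCk≤2^n (suc n) zero    = >-nonZero⁻¹ (2 ^ suc n) {{m^n≢0 2 (suc n)}}
nCk≤2^n (suc n) (suc k) = begin
  suc n C suc k        ≡⟨ nCk+nC[k+1]≡[n+1]C[k+1] n k ⟨
  n C k + n C suc k    ≤⟨ +-mono-≤ (nCk≤2^n n k) (nCk≤2^n n (suc k)) ⟩
  2 ^ n + 2 ^ n        ≡⟨ cong (_+_ (2 ^ n)) (+-identityʳ (2 ^ n)) ⟨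
  2 ^ suc n            ∎
  where open ≤-Reasoning

k≤n⇒nCk>0 : ∀ {n k} → k ≤ n → 0 < n C k
k≤n⇒nCk>0 {k = zero}          _         = s≤s z≤n
k≤n⇒nCk>0 {suc n} {k = suc k} (s≤s k≤n) = <-≤-trans (k≤n⇒nCk>0 k≤n)
  (≤-trans (m≤m+n (n C k) (n C suc k)) (≤-reflexive (nCk+nC[k+1]≡[n+1]C[k+1] n k)))

-- For w = 0 this is i (v C i) = v (v-1 C i-1); Pascal's rule raises w.
∣D*C : ∀ {D n v} → 0 < v → (∀ {i} → 0 < i → i ≤ n → i ∣ D) →
          ∀ w {m} → w < m → m ≤ n → v ∣ D * ((w + v) C m)
∣D*C {v = suc v} 0<v h zero {suc i} 0<i i≤n with h 0<i i≤n
... | divides q refl = subst (suc v ∣_) (sym (begin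
  q * suc i * (suc v C suc i)    ≡⟨ *-assoc q (suc i) _ ⟩
  q * (suc i * (suc v C suc i))  ≡⟨ cong (q *_) ([1+k]*[1+n]C[1+k]≡[1+n]*nCk v i) ⟩
  q * (suc v * (v C i))          ∎))
  (∣n⇒∣m*n q (m∣m*n (v C i)))
  where open ≡-Reasoning
∣D*C {D} {v = v} 0<v h (suc w) {suc m} (s≤s w<m) m<n = subst (v ∣_)
  (trans (sym (*-distribˡ-+ D _ _)) (cong (D *_) (nCk+nC[k+1]≡[n+1]C[k+1] (w + v) m)))
  (∣m∣n⇒∣m+n (∣D*C 0<v h w w<m (<⇒≤ m<n)) (∣D*C 0<v h w (m<n⇒m<1+n w<m) m<n))

commonMultiple≤2^2^ : ∀ k →
  ∃ λ D → 0 < D × (∀ {v} → 0 < v → v ≤ 2 ^ k → v ∣ D) × D ≤ 2 ^ (2 ^ suc k)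
commonMultiple≤2^2^ zero =
  1 , s≤s z≤n , (λ { (s≤s z≤n) (s≤s z≤n) → ∣-refl }) , s≤s z≤n
commonMultiple≤2^2^ (suc k) with commonMultiple≤2^2^ k
... | D , 0<D , h , D≤ = D * c , *-mono-≤ 0<D (k≤n⇒nCk>0 n≤2n) , h′ , (begin
  D * c                                ≤⟨ *-mono-≤ D≤ (nCk≤2^n (2 ^ suc k) n) ⟩
  2 ^ (2 ^ suc k) * 2 ^ (2 ^ suc k)    ≡⟨ ^-distribˡ-+-* 2 (2 ^ suc k) (2 ^ suc k) ⟨
  2 ^ (2 ^ suc k + 2 ^ suc k)          ≡⟨ cong (λ t → 2 ^ (2 ^ suc k + t)) (+-identityʳ (2 ^ suc k)) ⟨
  2 ^ (2 ^ suc (suc k))                ∎)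
  where
  open ≤-Reasoning
  n = 2 ^ k
  c = (2 ^ suc k) C n
  n≤2n : n ≤ 2 ^ suc k
  n≤2n = m≤m+n n _
  h′ : ∀ {v} → 0 < v → v ≤ 2 ^ suc k → v ∣ D * c
  h′ {v} 0<v v≤2n with ≤-<-connex v n
  ... | inj₁ v≤n = ∣m⇒∣m*n c (h 0<v v≤n)
  ... | inj₂ n<v = subst (λ t → v ∣ D * (t C n)) (m∸n+n≡m v≤2n)
    (∣D*C 0<v h (2 ^ suc k ∸ v)
      (+-cancelʳ-< v _ _ (begin-strict
        2 ^ suc k ∸ v + v   ≡⟨ m∸n+n≡m v≤2n ⟩
        n + (n + 0)         ≡⟨ cong (_+_ n) (+-identityʳ n) ⟩
        n + n               <⟨ +-monoʳ-< n n<v ⟩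
        n + v               ∎))
      ≤-refl)

∃2^k∈[N,2N] : ∀ N → 0 < N → ∃ λ k → N ≤ 2 ^ k × 2 ^ k ≤ 2 * N
∃2^k∈[N,2N] (suc zero) _ = 0 , ≤-refl , s≤s z≤n
∃2^k∈[N,2N] (suc N@(suc N′)) _ with ∃2^k∈[N,2N] N (s≤s z≤n)
... | k , N≤2^k , 2^k≤2N with m≤n⇒m<n∨m≡n N≤2^k
...   | inj₁ N<2^k = k , N<2^k , ≤-trans 2^k≤2N (*-monoʳ-≤ 2 (n≤1+n N))
...   | inj₂ N≡2^k = suc k
  , subst (λ t → suc N ≤ 2 * t) N≡2^k (s≤s (≤-trans (≤-reflexive (cong suc (sym (+-identityʳ N′)))) (m≤n+m _ N′)))
  , *-monoʳ-≤ 2 (≤-trans (≤-reflexive (sym N≡2^k)) (n≤1+n N))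

commonMultiple≤2^4N : ∀ N → 0 < N →
  ∃ λ D → 0 < D × (∀ {v} → 0 < v → v ≤ N → v ∣ D) × D ≤ 2 ^ (N * 4)
commonMultiple≤2^4N N 0<N with ∃2^k∈[N,2N] N 0<N
... | k , N≤2^k , 2^k≤2N with commonMultiple≤2^2^ k
...   | D , 0<D , h , D≤ = D , 0<D , (λ 0<v v≤N → h 0<v (≤-trans v≤N N≤2^k)) ,
  ≤-trans D≤ (^-monoʳ-≤ 2 (≤-trans (*-monoʳ-≤ 2 2^k≤2N) (≤-reflexive (2*[2*n]≡n*4 N))))
  where
  2*[2*n]≡n*4 : ∀ n → 2 * (2 * n) ≡ n * 4
  2*[2*n]≡n*4 = solve-∀

∏AP : ℕ → ℕ → ℕ → ℕ
∏AP a x zero    = x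
∏AP a x (suc m) = ∏AP a x m * (x + a * suc m)

∏AP-suc : ∀ a x m → ∏AP a x (suc m) ≡ x * ∏AP a (x + a) m
∏AP-suc a x zero    = cong (λ t → x * (x + t)) (*-identityʳ a)
∏AP-suc a x (suc m) = begin
  ∏AP a x (suc m) * (x + a * suc (suc m))           ≡⟨ cong₂ _*_ (∏AP-suc a x m) (eq a x m) ⟩
  x * ∏AP a (x + a) m * (x + a + a * suc m)         ≡⟨ *-assoc x _ _ ⟩
  x * ∏AP a (x + a) (suc m)                         ∎
  where
  open ≡-Reasoning
  eq : ∀ a x m → x + a * suc (suc m) ≡ x + a + a * suc m
  eq = solve-∀

-- Induction on m, from the two subproducts omitting the last and the first
-- factor: their difference is a (m+1).
∏AP∣a^m*m!*L : ∀ {a L} m x → (∀ j → j ≤ m → x + a * j ∣ L) → ∏AP a x m ∣ a ^ m * m ! * L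
∏AP∣a^m*m!*L {a} {L} zero x h =
  subst₂ _∣_ (trans (cong (_+_ x) (*-zeroʳ a)) (+-identityʳ x)) (sym (+-identityʳ L)) (h 0 z≤n)
∏AP∣a^m*m!*L {a} {L} (suc m) x h = subst (∏AP a x (suc m) ∣_) (eq₂ a (a ^ m) (m !) L m)
  (∣m+n∣m⇒∣n (subst (∏AP a x (suc m) ∣_) (eq₁ a x m W) last) first)
  where
  W = a ^ m * m ! * L
  last : ∏AP a x (suc m) ∣ W * (x + a * suc m)
  last = *-monoˡ-∣ (x + a * suc m) (∏AP∣a^m*m!*L m x λ j j≤m → h j (m≤n⇒m≤1+n j≤m))
  first : ∏AP a x (suc m) ∣ x * W
  first = subst (_∣ x * W) (sym (∏AP-suc a x m)) (*-monoʳ-∣ x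
    (∏AP∣a^m*m!*L m (x + a) λ j j≤m → subst (_∣ L)
      (trans (cong (_+_ x) (*-suc a j)) (sym (+-assoc x a (a * j)))) (h (suc j) (s≤s j≤m))))
  eq₁ : ∀ a x m w → w * (x + a * suc m) ≡ x * w + a * suc m * w
  eq₁ = solve-∀
  eq₂ : ∀ a p f l m → a * suc m * (p * f * l) ≡ a * p * (suc m * f) * l
  eq₂ = solve-∀

2^m*a^m*m!≤∏AP : ∀ {a x} m → 0 < x → a * m ≤ x → 2 ^ m * (a ^ m * m !) ≤ ∏AP a x m
2^m*a^m*m!≤∏AP zero 0<x _ = 0<x
2^m*a^m*m!≤∏AP {a} {x} (suc m) 0<x am≤x = begin
  2 ^ suc m * (a ^ suc m * suc m !)              ≡⟨ eq (2 ^ m) a (a ^ m) m (m !) ⟩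
  2 ^ m * (a ^ m * m !) * (a * suc m + a * suc m) ≤⟨ *-mono-≤
    (2^m*a^m*m!≤∏AP m 0<x (≤-trans (*-monoʳ-≤ a (n≤1+n m)) am≤x)) (+-monoˡ-≤ (a * suc m) am≤x) ⟩
  ∏AP a x (suc m)                                ∎
  where
  open ≤-Reasoning
  eq : ∀ t a p m f → 2 * t * (a * p * (suc m * f)) ≡ t * (p * f) * (a * suc m + a * suc m)
  eq = solve-∀

2^k≤L : ∀ {a b L} k → 0 < a → 0 < b → 0 < L → (∀ i → i ≤ 2 * k → a * i + b ∣ L) → 2 ^ k ≤ L
2^k≤L {a} {b} {L} k 0<a 0<b 0<L h = *-cancelʳ-≤ (2 ^ k) L (a ^ k * k !) (begin
  2 ^ k * (a ^ k * k !)   ≤⟨ 2^m*a^m*m!≤∏AP k (≤-trans 0<b (m≤n+m b (a * k))) (m≤m+n (a * k) b) ⟩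
  ∏AP a (a * k + b) k     ≤⟨ ∣⇒≤ (∏AP∣a^m*m!*L k (a * k + b) λ j j≤k → subst (_∣ L) (eq a b k j)
                               (h (k + j) (+-monoʳ-≤ k (≤-trans j≤k (m≤m+n k 0))))) ⟩
  a ^ k * k ! * L         ≡⟨ *-comm (a ^ k * k !) L ⟩
  L * (a ^ k * k !)       ∎)
  where
  open ≤-Reasoning
  instance
    a≢0 : NonZero a
    a≢0 = >-nonZero 0<a
    L≢0 : NonZero L
    L≢0 = >-nonZero 0<L
    a^k*k!≢0 : NonZero (a ^ k * k !)
    a^k*k!≢0 = m*n≢0 (a ^ k) (k !) {{m^n≢0 a k}} {{k !≢0}}
    a^k*k!*L≢0 : NonZero (a ^ k * k ! * L)
    a^k*k!*L≢0 = m*n≢0 (a ^ k * k !) L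
  eq : ∀ a b k j → a * (k + j) + b ≡ a * k + b + a * j
  eq = solve-∀

∑<-monoˡ : ∀ {m n} (f : ℕ → ℚ) → (∀ i → 0ℚ ℚ.≤ f i) → m ≤ n → ∑< m f ℚ.≤ ∑< n f
∑<-monoˡ {n = n} f 0≤f z≤n = ℚ.≤-trans
  (ℚ.≤-reflexive (sym (trans (∑<-const n 0ℚ) (ℚ.*-zeroʳ (+ n / 1)))))
  (∑<-mono n (λ _ → 0ℚ) f (λ i _ → 0≤f i))
∑<-monoˡ f 0≤f (s≤s m≤n) = ℚ.+-monoʳ-≤ (f 0) (∑<-monoˡ (λ i → f (suc i)) (λ i → 0≤f (suc i)) m≤n)

∑<-pred-2^suc : ∀ s (f : ℕ → ℚ) → let p = pred (2 ^ s) in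
                ∑< (pred (2 ^ suc s)) f ≡ ∑< (suc p) (λ j → f (p + j)) ℚ.+ ∑< p f
∑<-pred-2^suc s f = begin
  ∑< (pred (2 ^ suc s)) f                     ≡⟨ cong (λ t → ∑< (pred (t + (t + 0))) f)
                                                      (suc-pred (2 ^ s) {{m^n≢0 2 s}}) ⟨
  ∑< (p + suc (p + 0)) f                      ≡⟨ cong (λ t → ∑< (p + suc t) f) (+-identityʳ p) ⟩
  ∑< (p + suc p) f                            ≡⟨ ∑<-+ p (suc p) f ⟩
  ∑< p f ℚ.+ ∑< (suc p) (λ j → f (p + j))     ≡⟨ ℚ.+-comm (∑< p f) _ ⟩
  ∑< (suc p) (λ j → f (p + j)) ℚ.+ ∑< p f     ∎
  where
  open ≡-Reasoning
  p = pred (2 ^ s)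

∑<-2^-≤ : ∀ s → ∑< (pred (2 ^ s)) 1/1+_ ℚ.≤ ∑< s (λ _ → 1/1+ 0)
∑<-2^-≤ zero    = ℚ.≤-refl
∑<-2^-≤ (suc s) = ℚ.≤-trans (ℚ.≤-reflexive (∑<-pred-2^suc s 1/1+_))
  (ℚ.+-mono-≤ (block (pred (2 ^ s))) (∑<-2^-≤ s))
  where
  block : ∀ p → ∑< (suc p) (λ j → 1/1+ (p + j)) ℚ.≤ 1/1+ 0
  block p = ℚ.≤-trans
    (∑<-mono (suc p) (λ j → 1/1+ (p + j)) (λ _ → 1/1+ (p + 0)) λ j _ → 1/1+-anti (+-monoʳ-≤ p z≤n))
    (ℚ.≤-reflexive (∑<-1/1+ p 0))

∑<-2^-≥ : ∀ s → ∑< s (λ _ → 1/1+ 1) ℚ.≤ ∑< (pred (2 ^ s)) (λ i → 1/1+ (suc i))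
∑<-2^-≥ zero    = ℚ.≤-refl
∑<-2^-≥ (suc s) = ℚ.≤-trans
  (ℚ.+-mono-≤ (block (pred (2 ^ s))) (∑<-2^-≥ s))
  (ℚ.≤-reflexive (sym (∑<-pred-2^suc s (λ i → 1/1+ (suc i)))))
  where
  block : ∀ p → 1/1+ 1 ℚ.≤ ∑< (suc p) (λ j → 1/1+ (suc (p + j)))
  block p = ℚ.≤-trans (ℚ.≤-reflexive (sym (∑<-1/1+ p 1)))
    (∑<-mono (suc p) (λ _ → 1/1+ (p + 1 * suc p)) (λ j → 1/1+ (suc (p + j)))
      λ { j (s≤s j≤p) → 1/1+-anti (≤-trans (≤-reflexive (sym (+-suc p j)))
        (+-monoʳ-≤ p (s≤s (≤-trans j≤p (m≤m+n p 0))))) })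

-- Since any lower Darboux sum is at most any upper one, both bounds
-- can be read off from the sums of mesh 1, which are harmonic sums.
log-≤ : ∀ {n} s → n ≤ 2 ^ s → log n ≤ᵣ fromℚ (∑< s (λ _ → 1/1+ 0))
log-≤ {n} s n≤2^s m _ = ℚ.≤-trans (log-ordered n m 0) (ℚ.≤-trans
  (∑<-monoˡ 1/1+_ 1/1+-nonNeg (≤-trans (≤-reflexive (*-identityʳ (pred n))) (pred-mono-≤ n≤2^s)))
  (∑<-2^-≤ s))

log-≥ : ∀ {n} s → 2 ^ s ≤ n → fromℚ (∑< s (λ _ → 1/1+ 1)) ≤ᵣ log n
log-≥ {n} s 2^s≤n _ k = ℚ.≤-trans (∑<-2^-≥ s) (ℚ.≤-trans
  (∑<-monoˡ (λ i → 1/1+ (suc i)) (λ i → 1/1+-nonNeg (suc i))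
    (≤-trans (pred-mono-≤ 2^s≤n) (≤-reflexive (sym (*-identityʳ (pred n))))))
  (log-ordered n 0 k))

m+B>0 : ∀ B {m} → ℤ.∣ B ∣ < m → ∃ λ b → 0 < b × + m ℤ.+ B ≡ + b
m+B>0 (+ n)      {m} n<m = m + n , ≤-trans (≤-<-trans z≤n n<m) (m≤m+n m n) , refl
m+B>0 ℤ.-[1+ n ] {m} n<m = m ∸ suc n , m<n⇒0<n∸m n<m , ℤ.⊖-≥ (<⇒≤ n<m)

i*i≡∣i∣*∣i∣ : ∀ i → i ℤ.* i ≡ + (ℤ.∣ i ∣ * ℤ.∣ i ∣)
i*i≡∣i∣*∣i∣ (+ n)      = sym (ℤ.pos-* n n)
i*i≡∣i∣*∣i∣ ℤ.-[1+ n ] = refl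

-- Restricting n to the multiples of A makes the difference A², so the sign of A
-- plays no role.
positiveProgression : ∀ {P : ℤ → Set} A B → A ≢ 0ℤ → (∀ n → P (A ℤ.* n ℤ.+ B)) →
  ∃ λ a → ∃ λ b → 0 < a × 0 < b × (∀ i → P (+ (a * i + b)))
positiveProgression {P} A B A≢0 h with ℤ.∣ A ∣ * ℤ.∣ A ∣ in eq
... | a = go (m+B>0 B (m≤n*m c a {{>-nonZero 0<a}}))
  where
  0<a : 0 < a
  0<a = subst (0 <_) eq (>-nonZero⁻¹ _ {{m*n≢0 ℤ.∣ A ∣ ℤ.∣ A ∣ {{∣A∣≢0}} {{∣A∣≢0}}}})
    where
    ∣A∣≢0 : NonZero ℤ.∣ A ∣
    ∣A∣≢0 = ℤ.≢-nonZero A≢0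
  c = suc ℤ.∣ B ∣
  go : (∃ λ b → 0 < b × + (a * c) ℤ.+ B ≡ + b) →
       ∃ λ a → ∃ λ b → 0 < a × 0 < b × (∀ i → P (+ (a * i + b)))
  go (b , 0<b , b≡) = a , b , 0<a , 0<b , λ i → subst P (value-at i) (h (A ℤ.* (+ i ℤ.+ + c)))
    where
    A*A≡a : A ℤ.* A ≡ + a
    A*A≡a = trans (i*i≡∣i∣*∣i∣ A) (cong +_ eq)
    value-at : ∀ i → A ℤ.* (A ℤ.* (+ i ℤ.+ + c)) ℤ.+ B ≡ + (a * i + b)
    value-at i = begin
      A ℤ.* (A ℤ.* (+ i ℤ.+ + c)) ℤ.+ B
        ≡⟨ solve 4 (λ A B i c → A :* (A :* (i :+ c)) :+ B := A :* A :* i :+ (A :* A :* c :+ B))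
             refl A B (+ i) (+ c) ⟩
      A ℤ.* A ℤ.* + i ℤ.+ (A ℤ.* A ℤ.* + c ℤ.+ B)
        ≡⟨ cong (λ s → s ℤ.* + i ℤ.+ (s ℤ.* + c ℤ.+ B)) A*A≡a ⟩
      + a ℤ.* + i ℤ.+ (+ a ℤ.* + c ℤ.+ B)
        ≡⟨ cong₂ (λ s t → s ℤ.+ (t ℤ.+ B)) (ℤ.pos-* a i) (ℤ.pos-* a c) ⟨
      + (a * i) ℤ.+ (+ (a * c) ℤ.+ B)
        ≡⟨ cong (ℤ._+_ (+ (a * i))) b≡ ⟩
      + (a * i + b) ∎
      where
      open ≡-Reasoning
      open ℤ.+-*-Solver

lemma2p1 : (F : ℤ[x,y]) → HasDegree F 2 → RepresentsArbitrarilyLarge F →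
    LinearlyIndependent (∂x F) (∂y F) →
    (A B : ℤ) → A ≢ 0ℤ → (∀ (n : ℤ) → Represents F (A ℤ.* n ℤ.+ B)) →
    ∃ λ (c₁ : ℚ) → ∃ λ (c₂ : ℚ) → 0ℚ ℚ.< c₁ × 0ℚ ℚ.< c₂ ×
    ∃ λ (N₀ : ℕ) → ∀ (N : ℕ) → N₀ ≤ N → (ℓ : LCM (PositiveValuesUpTo F N)) →
    fromℚ (c₁ ℚ.* (+ N / 1)) ≤ᵣ ψ F N ℓ ×
    ψ F N ℓ ≤ᵣ fromℚ (c₂ ℚ.* (+ N / 1))
lemma2p1 F _ _ _ A B A≢0 prog with positiveProgression {Represents F} A B A≢0 prog
... | a , b , 0<a , 0<b , represents =
  c₁ , c₂
  , ℚ.positive⁻¹ c₁ {{ℚ.normalize-pos 1 (suc (r + 1 * suc r))}}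
  , ℚ.positive⁻¹ c₂ , q , bounds
  where
  q = suc (2 * a + b)
  r = pred (2 * q)
  c₁ = 1/1+ (r + 1 * suc r)
  c₂ = ∑< 4 (λ _ → 1/1+ 0)

  bounds : ∀ N → q ≤ N → (ℓ : LCM (PositiveValuesUpTo F N)) →
           fromℚ (c₁ ℚ.* (+ N / 1)) ≤ᵣ ψ F N ℓ × ψ F N ℓ ≤ᵣ fromℚ (c₂ ℚ.* (+ N / 1))
  bounds N q≤N ℓ with commonMultiple≤2^4N N (≤-trans (s≤s z≤n) q≤N)
  ... | D , 0<D , v∣D , D≤ = lowerBound , upperBound
    where
    L = value ℓ
    L∣D : L ∣ D
    L∣D = least ℓ λ (0<v , v≤N , _) → v∣D 0<v v≤N

    0<L : 0 < L
    0<L = n≢0⇒n>0 λ L≡0 → <⇒≢ 0<D (sym (0∣⇒≡0 (subst (_∣ D) L≡0 L∣D)))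

    t = N ℕ./ q
    0<t : 0 < t
    0<t = m≥n⇒m/n>0 q≤N

    a*i+b≤N : ∀ i → i ≤ 2 * t → a * i + b ≤ N
    a*i+b≤N i i≤2t = begin
      a * i + b                ≤⟨ +-mono-≤ (*-monoʳ-≤ a i≤2t) (m≤n*m b t {{>-nonZero 0<t}}) ⟩
      a * (2 * t) + t * b      ≤⟨ m≤n+m _ t ⟩
      t + (a * (2 * t) + t * b) ≡⟨ eq a b t ⟩
      t * q                    ≤⟨ m/n*n≤m N q ⟩
      N                        ∎
      where
      open ≤-Reasoning
      eq : ∀ a b t → t + (a * (2 * t) + t * b) ≡ t * suc (2 * a + b)
      eq = solve-∀

    N≤t*2q : N ≤ t * suc r
    N≤t*2q = begin
      N                  ≡⟨ m≡m%n+[m/n]*n N q ⟩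
      N ℕ.% q + t * q    ≤⟨ +-monoˡ-≤ (t * q)
                              (≤-trans (<⇒≤ (m%n<n N q)) (m≤n*m q t {{>-nonZero 0<t}})) ⟩
      t * q + t * q      ≡⟨ *-distribˡ-+ t q q ⟨
      t * (q + q)        ≡⟨ cong (λ s → t * (q + s)) (+-identityʳ q) ⟨
      t * suc r          ∎
      where open ≤-Reasoning

    2^t≤L : 2 ^ t ≤ L
    2^t≤L = 2^k≤L t 0<a 0<b 0<L λ i i≤2t → commonMultiple ℓ
      (≤-trans 0<b (m≤n+m b (a * i)) , a*i+b≤N i i≤2t , represents i)

    lowerBound : fromℚ (c₁ ℚ.* (+ N / 1)) ≤ᵣ ψ F N ℓ
    lowerBound m k = begin
      c₁ ℚ.* (+ N / 1)                    ≡⟨ ℚ.*-comm c₁ (+ N / 1) ⟩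
      (+ N / 1) ℚ.* c₁                    ≡⟨ ∑<-const N c₁ ⟨
      ∑< N (λ _ → c₁)                     ≤⟨ ∑<-monoˡ (λ _ → c₁)
                                               (λ _ → 1/1+-nonNeg (r + 1 * suc r)) N≤t*2q ⟩
      ∑< (t * suc r) (λ _ → c₁)           ≡⟨ ∑<-* t (suc r) (λ _ → c₁) ⟩
      ∑< t (λ _ → ∑< (suc r) (λ _ → c₁))  ≡⟨ ∑<-cong t (λ _ → ∑<-1/1+ r 1) ⟩
      ∑< t (λ _ → 1/1+ 1)                 ≤⟨ log-≥ t 2^t≤L m k ⟩
      log-upper L k                       ∎
      where open ℚ.≤-Reasoning

    upperBound : ψ F N ℓ ≤ᵣ fromℚ (c₂ ℚ.* (+ N / 1))
    upperBound m k = begin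
      log-lower L m                       ≤⟨ log-≤ (N * 4) (≤-trans (∣⇒≤ {{>-nonZero 0<D}} L∣D) D≤) m k ⟩
      ∑< (N * 4) (λ _ → 1/1+ 0)           ≡⟨ ∑<-* N 4 (λ _ → 1/1+ 0) ⟩
      ∑< N (λ _ → c₂)                     ≡⟨ ∑<-const N c₂ ⟩
      (+ N / 1) ℚ.* c₂                    ≡⟨ ℚ.*-comm (+ N / 1) c₂ ⟩
      c₂ ℚ.* (+ N / 1)                    ∎
      where open ℚ.≤-Reasoning
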